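{- Let $\Pi$ be a polar space of rank $n$ and let $m\le n$. Then the image of every isometric embedding of the hypercube graph $H_{m}$ in the Grassmann graph $\Gamma_{n-1}(\Pi)$ is an apartment in a parabolic subspace $[M\rangle_{n-1}$, where $M$ is an $(n-m-1)$-dimensional singular subspace of $\Pi$. In particular, the image of every isometric embedding of $H_{n}$ in $\Gamma_{n-1}(\Pi)$ is an apartment of ${\mathcal G}_{n-1}(\Pi)$.
   Context: A partial linear space is a pair $(P,\mathcal L)$ of a set of points and a family of proper subsets (lines), each with at least two points, every point on a line, and two distinct collinear points lying on exactly one line. A subspace is a set of points containing the line through any two of its distinct collinear points; it is singular if any two of its points are collinear; dimension of a subspace is the least $\alpha$ such that it is spanned by an independent set of size $\alpha+1$ (the empty set has dimension $-1$, points dimension $0$). A polar space is a partial linear space $\Pi=(P,\mathcal L)$ in which every line has at least three points, no point is collinear with all points, each point is collinear with exactly one or all points of any line, and every flag of singular subspaces is finite. Write $p\perp q$ for collinearity. If some maximal singular subspace contains more than one line, all maximal singular subspaces are projective spaces of the same dimension $n-1\ge 2$, and $n$ is the rank of $\Pi$. ${\mathcal G}_{k}(\Pi)$ denotes the set of $k$-dimensional singular subspaces. $\Gamma_{n-1}(\Pi)$ is the graph with vertex set ${\mathcal G}_{n-1}(\Pi)$ in which two maximal singular subspaces are adjacent iff their intersection is $(n-2)$-dimensional. For a singular subspace $M$ and $k>\dim M$, $[M\rangle_{k}$ is the set of elements of ${\mathcal G}_{k}(\Pi)$ containing $M$; $[M\rangle_{n-1}$ is called a parabolic subspace. A frame of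 a rank $n$ polar space is a set of $2n$ points $\{p_1,\dots,p_{2n}\}$ such that for each $i$ there is a unique $\sigma(i)$ with $p_i\not\perp p_{\sigma(i)}$. The apartment of ${\mathcal G}_{n-1}(\Pi)$ associated with a frame $B$ is the set of all maximal singular subspaces spanned by subsets of $B$ (i.e. $\langle p_{i_1},\dots,p_{i_n}\rangle$ with $\{i_1,\dots,i_n\}\cap\{\sigma(i_1),\dots,\sigma(i_n)\}=\emptyset$). If $M$ is a singular subspace and $B$ a frame such that $M$ is spanned by a subset of $B$, the intersection of the apartment associated with $B$ with $[M\rangle_{n-1}$ is called an apartment of $[M\rangle_{n-1}$ (for $M=\emptyset$ these are the apartments of ${\mathcal G}_{n-1}(\Pi)$). The hypercube graph $H_m$ has as vertices the maximal subsets $X\subset\{1,\dots,m,-1,\dots,-m\}$ containing no pair $i,-i$, two being adjacent iff they share $m-1$ elements. An isometric embedding of a graph in another is an injection on vertices preserving graph distance. -}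

module Defs where

open import Level using (Level; _⊔_) renaming (suc to lsuc)
open import Data.Nat using (ℕ; zero; suc; _+_; _∸_; _≤_; _*_)
open import Data.Fin using (Fin)
open import Data.Bool using (Bool)
open import Data.Vec using (Vec; []; _∷_)
open import Data.List using (List)
open import Data.List.Relation.Unary.Any using (Any)
open import Data.Product using (Σ; ∃; ∃-syntax; _×_; _,_)
open import Data.Sum using (_⊎_)
open import Relation.Nullary using (¬_)
open import Relation.Binary.PropositionalEquality using (_≡_; _≢_)

-- Incidence structures: points, lines, incidence.
-- Lines are given as a separate type; the partial-linear-space axiom
-- (two distinct points lie on at most one line) makes every line
-- determined by its point set, so this is the same as lines being subsets.

record Incidence : Set₁ where
  field
    Pt  : Set
    Ln  : Set
    _I_ : Pt → Ln → Set

module _ (Π : Incidence) where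
  open Incidence Π

  PSet : Set₁
  PSet = Pt → Set

  _⊆_ : PSet → PSet → Set
  X ⊆ Y = ∀ p → X p → Y p

  _≐_ : PSet → PSet → Set
  X ≐ Y = (X ⊆ Y) × (Y ⊆ X)

  _∩_ : PSet → PSet → PSet
  (X ∩ Y) p = X p × Y p

  _⊥_ : Pt → Pt → Set
  p ⊥ q = (p ≡ q) ⊎ (∃[ l ] (p I l × q I l))

  IsSubspace : PSet → Set
  IsSubspace S = ∀ a b c l → a ≢ b → S a → S b → a I l → b I l → c I l → S c

  IsSingular : PSet → Set
  IsSingular S = IsSubspace S × (∀ p q → S p → S q → p ⊥ q)

  IsMaxSingular : PSet → Set₁
  IsMaxSingular S = IsSingular S × (∀ T → IsSingular T → S ⊆ T → T ⊆ S)

  data Span (X : PSet) : PSet where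
    base : ∀ {p} → X p → Span X p
    line : ∀ {a b c l} → a ≢ b → Span X a → Span X b →
           a I l → b I l → c I l → Span X c

  Range : ∀ {k} → (Fin k → Pt) → PSet
  Range v p = ∃[ i ] (v i ≡ p)

  RangeExcept : ∀ {k} → (Fin k → Pt) → Fin k → PSet
  RangeExcept v i p = ∃[ j ] (j ≢ i × v j ≡ p)

  Independent : ∀ {k} → (Fin k → Pt) → Set
  Independent v = (∀ i j → v i ≡ v j → i ≡ j) ×
                  (∀ i → ¬ Span (RangeExcept v i) (v i))

  SpannedByIndependent : PSet → ℕ → Set
  SpannedByIndependent S k =
    Σ (Fin k → Pt) λ v → Independent v × (Span (Range v) ≐ S)

  -- DimSucc S k  ⇔  dim S = k - 1 : k is the least size of an
  -- independent set spanning S.  (dim ∅ = -1 corresponds to k = 0.)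
  DimSucc : PSet → ℕ → Set
  DimSucc S k = SpannedByIndependent S k ×
                (∀ k' → SpannedByIndependent S k' → k ≤ k')

  IsFlag : (PSet → Set) → Set₁
  IsFlag 𝓕 = (∀ S → 𝓕 S → IsSingular S) ×
             (∀ S T → 𝓕 S → 𝓕 T → (S ⊆ T) ⊎ (T ⊆ S))

  IsFiniteFamily : (PSet → Set) → Set₁
  IsFiniteFamily 𝓕 = Σ (List PSet) λ Ls → ∀ S → 𝓕 S → Any (λ T → S ≐ T) Ls

  ContainsLine : PSet → Ln → Set
  ContainsLine S l = ∀ p → p I l → S p

record IsPolarSpace (Π : Incidence) : Set₂ where
  open Incidence Π
  field
    line-proper     : ∀ l → ∃[ p ] (¬ p I l)
    point-on-line   : ∀ p → ∃[ l ] (p I l)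
    unique-line     : ∀ a b l l' → a ≢ b → a I l → b I l → a I l' → b I l' → l ≡ l'
    three-points    : ∀ l → ∃[ a ] ∃[ b ] ∃[ c ]
                        (a I l × b I l × c I l × a ≢ b × a ≢ c × b ≢ c)
    nondegenerate   : ∀ p → ∃[ q ] (¬ _⊥_ Π p q)
    one-or-all      : ∀ p l →
                        (∃[ q ] (q I l × _⊥_ Π p q ×
                                 (∀ q' → q' I l → _⊥_ Π p q' → q' ≡ q)))
                        ⊎ (∀ q → q I l → _⊥_ Π p q)
    flags-finite    : ∀ 𝓕 → IsFlag Π 𝓕 → IsFiniteFamily Π 𝓕

HasRank : (Π : Incidence) → ℕ → Set₁
HasRank Π n =
  (∃[ S ] (IsMaxSingular Π S × ∃[ l ] ∃[ l' ]
      (l ≢ l' × ContainsLine Π S l × ContainsLine Π S l')))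
  × (∀ S → IsMaxSingular Π S → DimSucc Π S n)

record Graph (a ℓ : Level) : Set (lsuc (a ⊔ ℓ)) where
  field
    V   : Set a
    _≈_ : V → V → Set ℓ
    Adj : V → V → Set ℓ

module _ {a ℓ : Level} (G : Graph a ℓ) where
  open Graph G

  data Walk : V → V → ℕ → Set (a ⊔ ℓ) where
    stop : ∀ {x y} → x ≈ y → Walk x y zero
    step : ∀ {x y z k} → Adj x y → Walk y z k → Walk x z (suc k)

  Dist : V → V → ℕ → Set (a ⊔ ℓ)
  Dist x y k = Walk x y k × (∀ j → Walk x y j → k ≤ j)

IsIsometricEmbedding : ∀ {a ℓ b ℓ'} (G : Graph a ℓ) (H : Graph b ℓ') →
                       (Graph.V G → Graph.V H) → Set (a ⊔ ℓ ⊔ b ⊔ ℓ')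
IsIsometricEmbedding G H f =
  (∀ x y → Graph._≈_ H (f x) (f y) → Graph._≈_ G x y) ×
  (∀ x y k → (Dist G x y k → Dist H (f x) (f y) k) ×
             (Dist H (f x) (f y) k → Dist G x y k))

-- The hypercube graph H_m.  A maximal subset of {±1,…,±m} without a pair
-- i,-i is encoded by a sign vector (true at i ↦ i in the set, false ↦ -i).
-- Two vertices share  #(agreeing coordinates)  elements.

agree : ∀ {m} → Vec Bool m → Vec Bool m → ℕ
agree [] [] = zero
agree (Data.Bool.true ∷ u) (Data.Bool.true ∷ v) = suc (agree u v)
agree (Data.Bool.false ∷ u) (Data.Bool.false ∷ v) = suc (agree u v)
agree (_ ∷ u) (_ ∷ v) = agree u v

Hypercube : ℕ → Graph Level.zero Level.zero
Hypercube m = record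
  { V = Vec Bool m
  ; _≈_ = _≡_
  ; Adj = λ u v → suc (agree u v) ≡ m
  }

MaxSub : Incidence → Set₁
MaxSub Π = Σ (PSet Π) (IsMaxSingular Π)

Grassmann : (Π : Incidence) → ℕ → Graph (lsuc Level.zero) Level.zero
Grassmann Π n = record
  { V = MaxSub Π
  ; _≈_ = λ S T → _≐_ Π (Data.Product.proj₁ S) (Data.Product.proj₁ T)
  ; Adj = λ S T → DimSucc Π (_∩_ Π (Data.Product.proj₁ S) (Data.Product.proj₁ T)) (n ∸ 1)
  }

module _ (Π : Incidence) where
  open Incidence Π

  IsFrame : (n : ℕ) → (Fin (2 * n) → Pt) → Set
  IsFrame n B = (∀ i j → B i ≡ B j → i ≡ j) ×
                (∀ i → ∃[ j ] (¬ _⊥_ Π (B i) (B j) ×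
                              (∀ j' → ¬ _⊥_ Π (B i) (B j') → j' ≡ j)))

  SpannedBySubsetOf : ∀ {k} → (Fin k → Pt) → PSet Π → Set₁
  SpannedBySubsetOf B S = ∃[ X ] (_⊆_ Π X (Range Π B) × _≐_ Π (Span Π X) S)

  InApartment : ∀ {k} → (Fin k → Pt) → MaxSub Π → Set₁
  InApartment B S = SpannedBySubsetOf B (Data.Product.proj₁ S)

  InApartmentOver : ∀ {k} → (Fin k → Pt) → PSet Π → MaxSub Π → Set₁
  InApartmentOver B M S = InApartment B S × _⊆_ Π M (Data.Product.proj₁ S)

  InImage : ∀ {m} → (Vec Bool m → MaxSub Π) → MaxSub Π → Set
  InImage f S = ∃[ x ] (_≐_ Π (Data.Product.proj₁ (f x)) (Data.Product.proj₁ S))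

{-# OPTIONS --safe #-}

-- For a set X of pairwise collinear points, Span X = X^⊥⊥: if p is collinear with X,
-- either p ∈ Span X or some t ∈ X^⊥ is not collinear with p. To find t, choose z not
-- collinear with some x ∈ X and project X and p from x into {x,z}^⊥, which is again
-- nondegenerate. This gives the dimension theory of singular subspaces, and shows that
-- the distance of two maximal ones is the codimension of their intersection.
--
-- Consequently the vertices w of the cube whose image contains a given point form a
-- convex set. The images of two antipodal vertices meet in M, the intersection of all
-- images; a facet of the cube has an intersection one dimension larger, which yields a
-- point outside M. These 2m points together with hyperbolic partners for a basis of M
-- form the frame.
--
-- Point equality is not assumed decidable: it follows from one-or-all.
module Submission where

open import Defs
open import Data.Nat using (ℕ; zero; suc; _+_; _≤_; _<_; z≤n; s≤s; _∸_; _*_)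
import Data.Nat.Properties as ℕ
open import Data.Fin using (Fin; zero; suc)
import Data.Fin as Fin
import Data.Fin.Properties as Fin
open import Data.Bool using (Bool; true; false; not)
import Data.Bool.Properties as Bool
open import Data.Vec using (Vec; []; _∷_)
import Data.Vec as Vec
import Data.Vec.Properties as Vec
open import Data.List using (List; []; _∷_; _++_; length; map; tabulate; lookup)
import Data.List.Properties as List
open import Data.List.Membership.Propositional using (_∈_; find)
import Data.List.Membership.Propositional.Properties as ∈
open import Data.List.Relation.Unary.Any using (here; there)
import Data.List.Relation.Unary.Any.Properties as Any
open import Data.List.Relation.Unary.All using (All; []; _∷_)
import Data.List.Relation.Unary.All as All
import Data.List.Relation.Unary.All.Properties as All
open import Data.Product using (Σ; ∃-syntax; _×_; _,_; proj₁; proj₂; swap)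
open import Data.Sum using (_⊎_; inj₁; inj₂)
open import Data.Unit using (⊤; tt)
open import Function using (_∘_; _↔_; Inverse)
open import Function.Construct.Composition using (_↔-∘_)
open import Data.Product.Function.NonDependent.Propositional using (_×-↔_)
import Data.Sum.Properties as Sum
open import Relation.Nullary using (¬_; Dec; yes; no; contradiction)
open import Relation.Nullary.Decidable using (_×-dec_)
open import Relation.Binary.PropositionalEquality using (_≡_; _≢_; refl; sym; trans; cong; subst)

-- Hamming distance as the graph distance of the hypercube.

hamming : ∀ {m} → Vec Bool m → Vec Bool m → ℕ
hamming [] [] = 0
hamming (true ∷ u) (true ∷ v) = hamming u v
hamming (false ∷ u) (false ∷ v) = hamming u v
hamming (true ∷ u) (false ∷ v) = suc (hamming u v)
hamming (false ∷ u) (true ∷ v) = suc (hamming u v)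

hamming-∷ : ∀ {m} b (u v : Vec Bool m) → hamming (b ∷ u) (b ∷ v) ≡ hamming u v
hamming-∷ true u v = refl
hamming-∷ false u v = refl

hamming-refl : ∀ {m} (u : Vec Bool m) → hamming u u ≡ 0
hamming-refl [] = refl
hamming-refl (b ∷ u) = trans (hamming-∷ b u u) (hamming-refl u)

hamming-triangle : ∀ {m} (u v w : Vec Bool m) → hamming u w ≤ hamming u v + hamming v w
hamming-triangle [] [] [] = z≤n
hamming-triangle (true ∷ u) (true ∷ v) (true ∷ w) = hamming-triangle u v w
hamming-triangle (true ∷ u) (true ∷ v) (false ∷ w) =
  ℕ.≤-trans (s≤s (hamming-triangle u v w)) (ℕ.≤-reflexive (sym (ℕ.+-suc _ _)))
hamming-triangle (true ∷ u) (false ∷ v) (true ∷ w) =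
  ℕ.≤-trans (hamming-triangle u v w) (ℕ.+-mono-≤ (ℕ.n≤1+n _) (ℕ.n≤1+n _))
hamming-triangle (true ∷ u) (false ∷ v) (false ∷ w) = s≤s (hamming-triangle u v w)
hamming-triangle (false ∷ u) (true ∷ v) (true ∷ w) = s≤s (hamming-triangle u v w)
hamming-triangle (false ∷ u) (true ∷ v) (false ∷ w) =
  ℕ.≤-trans (hamming-triangle u v w) (ℕ.+-mono-≤ (ℕ.n≤1+n _) (ℕ.n≤1+n _))
hamming-triangle (false ∷ u) (false ∷ v) (true ∷ w) =
  ℕ.≤-trans (s≤s (hamming-triangle u v w)) (ℕ.≤-reflexive (sym (ℕ.+-suc _ _)))
hamming-triangle (false ∷ u) (false ∷ v) (false ∷ w) = hamming-triangle u v w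

hamming+agree : ∀ {m} (u v : Vec Bool m) → hamming u v + agree u v ≡ m
hamming+agree [] [] = refl
hamming+agree (true ∷ u) (true ∷ v) = trans (ℕ.+-suc _ _) (cong suc (hamming+agree u v))
hamming+agree (false ∷ u) (false ∷ v) = trans (ℕ.+-suc _ _) (cong suc (hamming+agree u v))
hamming+agree (true ∷ u) (false ∷ v) = cong suc (hamming+agree u v)
hamming+agree (false ∷ u) (true ∷ v) = cong suc (hamming+agree u v)

agree-refl : ∀ {m} (u : Vec Bool m) → agree u u ≡ m
agree-refl u = subst (λ h → h + agree u u ≡ _) (hamming-refl u) (hamming+agree u u)

walk-∷ : ∀ {m k} b {u v : Vec Bool m} → Walk (Hypercube m) u v k →
         Walk (Hypercube (suc m)) (b ∷ u) (b ∷ v) k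
walk-∷ b (stop refl) = stop refl
walk-∷ true (step adj w) = step (cong suc adj) (walk-∷ true w)
walk-∷ false (step adj w) = step (cong suc adj) (walk-∷ false w)

hypercube-walk : ∀ {m} (u v : Vec Bool m) → Walk (Hypercube m) u v (hamming u v)
hypercube-walk [] [] = stop refl
hypercube-walk (true ∷ u) (true ∷ v) = walk-∷ true (hypercube-walk u v)
hypercube-walk (false ∷ u) (false ∷ v) = walk-∷ false (hypercube-walk u v)
hypercube-walk (true ∷ u) (false ∷ v) =
  step (cong suc (agree-refl u)) (walk-∷ false (hypercube-walk u v))
hypercube-walk (false ∷ u) (true ∷ v) =
  step (cong suc (agree-refl u)) (walk-∷ true (hypercube-walk u v))

hamming-least : ∀ {m} (u v : Vec Bool m) j → Walk (Hypercube m) u v j → hamming u v ≤ j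
hamming-least u _ _ (stop refl) = ℕ.≤-reflexive (hamming-refl u)
hamming-least u v _ (step {y = w} {k = j} adj walk) =
  ℕ.≤-trans (hamming-triangle u w v) (ℕ.+-mono-≤ one (hamming-least w v j walk))
  where
  one : hamming u w ≤ 1
  one = ℕ.≤-reflexive (ℕ.+-cancelʳ-≡ (agree u w) _ _ (trans (hamming+agree u w) (sym adj)))

hypercube-dist : ∀ {m} (u v : Vec Bool m) → Dist (Hypercube m) u v (hamming u v)
hypercube-dist u v = hypercube-walk u v , hamming-least u v

-- Intervals and convex sets of vertices.

Between : ∀ {m} (a w b : Vec Bool m) → Set
Between a w b = ∀ i → Vec.lookup w i ≡ Vec.lookup a i ⊎ Vec.lookup w i ≡ Vec.lookup b i

-- Closure is required only for the first vertex after `x` on a geodesic from `x` to `y`; whole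
-- intervals follow in `convex-between`.
Convex : ∀ {m} → (Vec Bool m → Set) → Set
Convex P = ∀ x w y → hamming x w ≡ 1 → hamming x y ≡ suc (hamming w y) → P x → P y → P w

convex-∷ : ∀ {m P} b → Convex {suc m} P → Convex (P ∘ (b ∷_))
convex-∷ b conv x w y xw xy = conv (b ∷ x) (b ∷ w) (b ∷ y)
  (trans (hamming-∷ b x w) xw)
  (trans (hamming-∷ b x y) (trans xy (cong suc (sym (hamming-∷ b w y)))))

-- If the heads differ, `a ∷ y` is a neighbour of `b ∷ y` on a geodesic towards `a ∷ x`.
convex-head : ∀ {m P} → Convex {suc m} P → ∀ a b x y → P (a ∷ x) → P (b ∷ y) → P (a ∷ y)
convex-head conv true true x y Px Py = Py
convex-head conv false false x y Px Py = Py
convex-head conv true false x y Px Py =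
  conv (false ∷ y) (true ∷ y) (true ∷ x) (cong suc (hamming-refl y)) refl Py Px
convex-head conv false true x y Px Py =
  conv (true ∷ y) (false ∷ y) (false ∷ x) (cong suc (hamming-refl y)) refl Py Px

-- The head of `w` agrees with one of the ends; `convex-head` moves the other end into the same
-- facet, and the tails are treated recursively.
convex-between : ∀ {m P} → Convex {m} P → ∀ a w b → Between a w b → P a → P b → P w
convex-between conv [] [] [] _ Pa _ = Pa
convex-between {P = P} conv (a ∷ as) (w ∷ ws) (b ∷ bs) btw Pa Pb =
  convex-between (convex-∷ {P = P} w conv) as ws bs (btw ∘ suc) (proj₁ ends) (proj₂ ends)
  where
  ends : P (w ∷ as) × P (w ∷ bs)
  ends with btw zero
  ... | inj₁ refl = Pa , convex-head {P = P} conv w b as bs Pa Pb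
  ... | inj₂ refl = convex-head {P = P} conv w a bs as Pb Pa , Pb

between-poles : ∀ {m} (w : Vec Bool m) → Between (Vec.replicate m true) w (Vec.replicate m false)
between-poles w i with Vec.lookup w i
... | true = inj₁ (sym (Vec.lookup-replicate i true))
... | false = inj₂ (sym (Vec.lookup-replicate i false))

between-antipodes : ∀ {m} (v w : Vec Bool m) → Between v w (Vec.map not v)
between-antipodes v w i with Vec.lookup w i Bool.≟ Vec.lookup v i
... | yes w≡v = inj₁ w≡v
... | no w≢v = inj₂ (trans (Bool.¬-not w≢v) (sym (Vec.lookup-map i not v)))

between-face : ∀ {m} (w : Vec Bool m) i →
  Between (Vec.replicate m true Vec.[ i ]≔ Vec.lookup w i) w (Vec.replicate m false Vec.[ i ]≔ Vec.lookup w i)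
between-face w i j with j Fin.≟ i
... | yes refl = inj₁ (sym (Vec.lookup∘update i (Vec.replicate _ true) _))
... | no j≢i with between-poles w j
... | inj₁ e = inj₁ (trans e (sym (Vec.lookup∘update′ j≢i (Vec.replicate _ true) _)))
... | inj₂ e = inj₂ (trans e (sym (Vec.lookup∘update′ j≢i (Vec.replicate _ false) _)))

hamming-poles : ∀ m → hamming (Vec.replicate m true) (Vec.replicate m false) ≡ m
hamming-poles zero = refl
hamming-poles (suc m) = cong suc (hamming-poles m)

hamming-face : ∀ {m} (i : Fin m) b →
  suc (hamming (Vec.replicate m true Vec.[ i ]≔ b) (Vec.replicate m false Vec.[ i ]≔ b)) ≡ m
hamming-face {suc m} zero b = cong suc (trans (hamming-∷ b _ _) (hamming-poles m))
hamming-face (suc i) b = cong suc (hamming-face i b)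

-- Collinearity, nondegenerate subspaces and decidability of point equality.

module PolarSpace (Π : Incidence) (polar : IsPolarSpace Π) where
  open Incidence Π
  open IsPolarSpace polar

  infix 4 _⟂_

  _⟂_ : Pt → Pt → Set
  _⟂_ = _⊥_ Π

  ⟂-sym : ∀ {p q} → p ⟂ q → q ⟂ p
  ⟂-sym (inj₁ p≡q) = inj₁ (sym p≡q)
  ⟂-sym (inj₂ (l , pl , ql)) = inj₂ (l , ql , pl)

  ⟂-line : ∀ {z a b c l} → a ≢ b → a I l → b I l → c I l → z ⟂ a → z ⟂ b → z ⟂ c
  ⟂-line {z} {l = l} a≢b al bl cl za zb with one-or-all z l
  ... | inj₂ all = all _ cl
  ... | inj₁ (_ , _ , _ , uniq) = contradiction (trans (uniq _ al za) (sym (uniq _ bl zb))) a≢b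

  join : ∀ {a b} → a ⟂ b → a ≢ b → ∃[ l ] (a I l × b I l)
  join (inj₁ a≡b) a≢b = contradiction a≡b a≢b
  join (inj₂ lab) _ = lab

  foot : ∀ {z b l} → b I l → ¬ z ⟂ b →
         ∃[ q ] (q I l × z ⟂ q × (∀ q' → q' I l → z ⟂ q' → q' ≡ q))
  foot {z} {l = l} bl ¬zb with one-or-all z l
  ... | inj₁ foot = foot
  ... | inj₂ all = contradiction (all _ bl) ¬zb

  -- Subspaces with empty radical. `opposite` takes the place of the axiom `nondegenerate`, so that
  -- arguments can be repeated inside the perp of a noncollinear pair.
  record NonDegenerate (R : PSet Π) : Set where
    field
      subspace : IsSubspace Π R
      opposite : ∀ p → R p → ∃[ q ] (R q × ¬ q ⟂ p)

  open NonDegenerate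

  everything : NonDegenerate (λ _ → ⊤)
  everything .subspace _ _ _ _ _ _ _ _ _ _ = tt
  everything .opposite p _ with nondegenerate p
  ... | q , ¬pq = q , tt , ¬pq ∘ ⟂-sym

  Separates : PSet Π → Ln → Pt → Set
  Separates R l a = ∃[ z ] (R z × z ⟂ a × ∃[ b ] (b I l × ¬ z ⟂ b))

  -- Decided by one-or-all on the line joining a to the separating point: among
  -- the points of l, only a is collinear with that whole line.
  separated⇒≡? : ∀ {R l a q} → a I l → q I l → Separates R l a → Dec (q ≡ a)
  separated⇒≡? {q = q} al ql (z , _ , za , b , bl , ¬zb) with foot bl ¬zb
  ... | c , cl , zc , uniq with join za (λ { refl → ¬zb (inj₂ (_ , al , bl)) })
  ...   | k , zk , ak with one-or-all q k
  ...     | inj₂ all = yes (trans (uniq q ql (⟂-sym (all z zk))) (sym (uniq _ al za)))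
  ...     | inj₁ (_ , _ , _ , only) = no λ { refl →
              ¬zb (inj₂ (_ , subst (_I _) (trans (only _ ak (inj₁ refl)) (sym (only z zk (⟂-sym za)))) al , bl)) }

  -- Let `c` be the foot on `l` of some `x` not collinear with `r`, and let `y` be not collinear
  -- with `c`. If the foot `d` of `y` on `l` is `r`, then `y` separates. Otherwise take the foot `w`
  -- of `y` on the line `xc`, and then the foot `z` of `r` on the line `yw`.
  separate : ∀ {R l r} → NonDegenerate R → (∀ p → p I l → R p) → r I l → Separates R l r
  separate {R} {l} {r} nd l⊆R rl with nd .opposite r (l⊆R r rl)
  ... | x , Rx , ¬xr with foot rl ¬xr
  ... | c , cl , xc , _ with nd .opposite c (l⊆R c cl)
  ... | y , Ry , ¬yc with foot cl ¬yc
  ... | d , dl , yd , d-uniq with separated⇒≡? {R = R} dl rl (y , Ry , yd , c , cl , ¬yc)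
  ... | yes refl = y , Ry , yd , c , cl , ¬yc
  ... | no r≢d with join xc (λ { refl → ¬xr (inj₂ (l , cl , rl)) })
  ... | k , xk , ck with foot ck ¬yc
  ... | w , wk , yw , _ with join yw (λ { refl → ¬yc (inj₂ (k , wk , ck)) })
  ... | j , yj , wj with foot {z = r} yj (λ ry → r≢d (d-uniq r rl (⟂-sym ry)))
  ... | z , zj , rz , _ = z , Rz , ⟂-sym rz , c , cl , ¬zc
    where
    w≢c : w ≢ c
    w≢c refl = ¬yc yw
    Rw : R w
    Rw = nd .subspace x c w k (λ { refl → ¬xr (inj₂ (l , cl , rl)) }) Rx (l⊆R c cl) xk ck wk
    Rz : R z
    Rz = nd .subspace y w z j (λ { refl → ¬yc (inj₂ (k , wk , ck)) }) Ry Rw yj wj zj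
    -- `w` is the only point of `j` collinear with `c`, so `z` would be `w`; then `r`, collinear
    -- with `w` and `c`, would be collinear with `x`.
    ¬zc : ¬ z ⟂ c
    ¬zc zc with foot {z = c} yj (¬yc ∘ ⟂-sym)
    ... | _ , _ , _ , uniq with trans (uniq z zj (⟂-sym zc)) (sym (uniq w wj (inj₂ (k , ck , wk))))
    ... | refl = ¬xr (⟂-sym (⟂-line w≢c wk ck xk rz (inj₂ (l , rl , cl))))

  collinear⇒≡? : ∀ {p q} → p ⟂ q → Dec (p ≡ q)
  collinear⇒≡? (inj₁ p≡q) = yes p≡q
  collinear⇒≡? (inj₂ (l , pl , ql)) = separated⇒≡? ql pl (separate everything (λ _ _ → tt) ql)

  infix 4 _⟂?_ _≟_

  -- Comparing `q` with the foot of `p` on a line through `q` only needs equality of collinear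
  -- points, which `separate` has made decidable. General equality comes afterwards.
  _⟂?_ : ∀ p q → Dec (p ⟂ q)
  p ⟂? q with point-on-line q
  ... | l , ql with one-or-all p l
  ... | inj₂ all = yes (all q ql)
  ... | inj₁ (r , rl , pr , uniq) with collinear⇒≡? {q} {r} (inj₂ (l , ql , rl))
  ... | yes refl = yes pr
  ... | no q≢r = no (λ pq → q≢r (uniq q ql pq))

  _≟_ : (p q : Pt) → Dec (p ≡ q)
  p ≟ q with p ⟂? q
  ... | yes pq = collinear⇒≡? pq
  ... | no ¬pq = no (¬pq ∘ inj₁)

  Cut : PSet Π → Pt → Pt → PSet Π
  Cut R a b p = R p × a ⟂ p × b ⟂ p

  -- For `p` in the cut, take `z` collinear with `a` but not with the whole line `ap`. The foot `w`
  -- of `b` on the line `za` lies in the cut. Were it collinear with `p`, then `z` would be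
  -- collinear with `p` too, hence with the whole line `ap`.
  cut : ∀ {R a b} → NonDegenerate R → R a → R b → ¬ b ⟂ a → NonDegenerate (Cut R a b)
  cut nd _ _ _ .subspace p q r l p≢q (Rp , ap , bp) (Rq , aq , bq) pl ql rl =
    nd .subspace p q r l p≢q Rp Rq pl ql rl ,
    ⟂-line p≢q pl ql rl ap aq , ⟂-line p≢q pl ql rl bp bq
  cut {R} {a} {b} nd Ra Rb ¬ba .opposite p (Rp , ap , bp)
    with join ap (λ { refl → ¬ba bp })
  ... | l , al , pl with separate nd (λ q ql → nd .subspace a p q l (λ { refl → ¬ba bp }) Ra Rp al pl ql) al
  ... | z , Rz , za , c , cl , ¬zc with join za (λ { refl → ¬zc (inj₂ (l , al , cl)) })
  ... | k , zk , ak with foot {z = b} ak ¬ba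
  ... | w , wk , bw , _ = w , (nd .subspace z a w k (λ { refl → ¬zc (inj₂ (l , al , cl)) }) Rz Ra zk ak wk
                             , inj₂ (k , ak , wk) , bw) , ¬wp
    where
    ¬wp : ¬ w ⟂ p
    ¬wp wp = ¬zc (⟂-line (λ { refl → ¬ba bp }) al pl cl za
                   (⟂-sym (⟂-line (λ { refl → ¬ba bw }) wk ak zk (⟂-sym wp) (⟂-sym ap))))

  -- Spans and singular subspaces.

  ⟪_⟫ : List Pt → PSet Π
  ⟪ X ⟫ = Span Π (_∈ X)

  span-subspace : ∀ {Z} → IsSubspace Π (Span Π Z)
  span-subspace _ _ _ _ a≢b Sa Sb al bl cl = line a≢b Sa Sb al bl cl

  ⟂-subspace : ∀ z → IsSubspace Π (z ⟂_)
  ⟂-subspace z _ _ _ _ a≢b za zb al bl cl = ⟂-line a≢b al bl cl za zb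

  span-minimal : ∀ {Z T} → IsSubspace Π T → _⊆_ Π Z T → _⊆_ Π (Span Π Z) T
  span-minimal sub Z⊆T p (base Zp) = Z⊆T p Zp
  span-minimal sub Z⊆T p (line a≢b Sa Sb al bl pl) =
    sub _ _ _ _ a≢b (span-minimal sub Z⊆T _ Sa) (span-minimal sub Z⊆T _ Sb) al bl pl

  ⟪⟫-minimal : ∀ {X T p} → IsSubspace Π T → All T X → ⟪ X ⟫ p → T p
  ⟪⟫-minimal sub X⊆T = span-minimal sub (λ _ → All.lookup X⊆T) _

  ⟪⟫-there : ∀ {X p q} → ⟪ X ⟫ p → ⟪ q ∷ X ⟫ p
  ⟪⟫-there = span-minimal span-subspace (λ _ → base ∘ there) _

  span-singular : ∀ {Z} → (∀ p q → Z p → Z q → p ⟂ q) → IsSingular Π (Span Π Z)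
  span-singular {Z} clique = span-subspace , λ p q Sp Sq →
    span-minimal (⟂-subspace p)
      (λ z Zz → ⟂-sym (span-minimal (⟂-subspace z) (λ y → clique z y Zz) p Sp)) q Sq

  ∩-singular : ∀ {S T} → IsSingular Π S → IsSingular Π T → IsSingular Π (_∩_ Π S T)
  ∩-singular (subS , clique) (subT , _) =
    (λ a b c l a≢b (Sa , Ta) (Sb , Tb) al bl cl →
       subS a b c l a≢b Sa Sb al bl cl , subT a b c l a≢b Ta Tb al bl cl)
    , λ p q (Sp , _) (Sq , _) → clique p q Sp Sq

  -- Independence, witnessed by points that separate each entry from all later ones.
  data Triangular : List Pt → Set where
    []     : Triangular []
    triang : ∀ {q X} z → ¬ z ⟂ q → All (z ⟂_) X → Triangular X → Triangular (q ∷ X)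

  -- Gaussian elimination by collinearity.

  project : ∀ {S x p u} → IsSingular Π S → S x → S p → ¬ u ⟂ x → p ≢ x →
            ∃[ q ] ∃[ l ] (S q × u ⟂ q × q ≢ x × x I l × p I l × q I l)
  project {x = x} {p} (sub , clique) Sx Sp ¬ux p≢x with join (clique p x Sp Sx) p≢x
  ... | l , pl , xl with foot xl ¬ux
  ... | q , ql , uq , _ =
    q , l , sub p x q l p≢x Sp Sx pl xl ql , uq , (λ { refl → ¬ux uq }) , xl , pl , ql

  -- Collinearity with `s` acts as a linear functional: one pivot off its kernel s^⊥, and the other
  -- generators moved into it. In general `rest` may lose several entries; `tri` says that a
  -- triangular list loses only one.
  record Elimination (s : Pt) (X : List Pt) : Set where
    field
      pivot  : Pt
      rest   : List Pt
      pivot∈ : ⟪ X ⟫ pivot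
      ¬⟂     : ¬ s ⟂ pivot
      rest⊆  : All ⟪ X ⟫ rest
      rest⟂  : All (s ⟂_) rest
      spans  : All ⟪ pivot ∷ rest ⟫ X
      short  : length rest < length X
      tri    : Triangular X → Triangular rest × length X ≤ suc (length rest)

  open Elimination

  eliminate : ∀ {S X} → IsSingular Π S → All S X → ∀ s → All (s ⟂_) X ⊎ Elimination s X
  eliminate sing [] s = inj₁ []
  eliminate {X = q ∷ X} sing (Sq ∷ SX) s with eliminate sing SX s
  ... | inj₁ sX with s ⟂? q
  ...   | yes sq = inj₁ (sq ∷ sX)
  ...   | no ¬sq = inj₂ record
    { pivot = q ; rest = X ; pivot∈ = base (here refl) ; ¬⟂ = ¬sq
    ; rest⊆ = All.tabulate (base ∘ there) ; rest⟂ = sX ; spans = All.tabulate base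
    ; short = ℕ.≤-refl ; tri = λ { (triang _ _ _ t) → t , ℕ.≤-refl } }
  eliminate {X = q ∷ X} sing (Sq ∷ SX) s | inj₂ E with q ≟ pivot E
  -- `q` is redundant and dropped. For triangular lists this cannot occur: the point separating `q`
  -- from `X` would be collinear with the pivot, which is `q`.
  ... | yes refl = inj₂ record
    { pivot = q ; rest = rest E ; pivot∈ = base (here refl) ; ¬⟂ = ¬⟂ E
    ; rest⊆ = All.map ⟪⟫-there (rest⊆ E) ; rest⟂ = rest⟂ E ; spans = base (here refl) ∷ spans E
    ; short = ℕ.m≤n⇒m≤1+n (short E)
    ; tri = λ { (triang z ¬zq zX _) → contradiction (⟪⟫-minimal (⟂-subspace z) zX (pivot∈ E)) ¬zq } }
  -- The foot `q'` of `s` on the line from `q` to the pivot replaces `q`; if `s` is already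
  -- collinear with `q`, it is `q` itself.
  ... | no q≢x with project sing (⟪⟫-minimal (proj₁ sing) SX (pivot∈ E)) Sq (¬⟂ E) q≢x
  ... | q' , l , _ , sq' , q'≢x , xl , ql , q'l = inj₂ record
    { pivot = pivot E ; rest = q' ∷ rest E ; pivot∈ = ⟪⟫-there (pivot∈ E) ; ¬⟂ = ¬⟂ E
    ; rest⊆ = line q≢x (base (here refl)) (⟪⟫-there (pivot∈ E)) ql xl q'l ∷ All.map ⟪⟫-there (rest⊆ E)
    ; rest⟂ = sq' ∷ rest⟂ E
    ; spans = line q'≢x (base (there (here refl))) (base (here refl)) q'l xl ql
              ∷ All.map (⟪⟫-minimal span-subspace
                          (base (here refl) ∷ All.tabulate (base ∘ there ∘ there))) (spans E)
    ; short = s≤s (short E)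
    ; tri = λ { (triang z ¬zq zX t) →
        let z⟂ = λ {p} → ⟪⟫-minimal {p = p} (⟂-subspace z) zX
            t' , le = tri E t
        in triang z (λ zq' → ¬zq (⟂-line q'≢x q'l xl ql zq' (z⟂ (pivot∈ E))))
                  (All.map z⟂ (rest⊆ E)) t'
         , s≤s le } }

  -- Hyperbolic pairs and the double perp of a span.

  Hyperbolic : PSet Π → List (Pt × Pt) → Set
  Hyperbolic R [] = ⊤
  Hyperbolic R ((a , b) ∷ L) = R a × R b × ¬ b ⟂ a × Hyperbolic (Cut R a b) L

  -- Eliminating `X` against an opposite `z` of its first entry gives a hyperbolic pair of the pivot
  -- and `z`, with the rest inside their perp, where the process continues. The rest is not a
  -- sublist of `X`, so `k` bounds the recursion.
  normalise : ∀ k {R S X} → NonDegenerate R → IsSingular Π S → All S X → All R X → length X ≤ k →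
              ∃[ L ] (Hyperbolic R L × All ⟪ X ⟫ (map proj₁ L) × All ⟪ map proj₁ L ⟫ X ×
                      length L ≤ length X)
  normalise k {X = []} _ _ _ _ _ = [] , tt , [] , [] , z≤n
  normalise (suc k) {R} {S} {q ∷ X} nd sing SX (Rq ∷ RX) (s≤s le) with nd .opposite q Rq
  ... | z , Rz , ¬zq with eliminate sing SX z
  ... | inj₁ (zq ∷ _) = contradiction zq ¬zq
  ... | inj₂ E = extend (normalise k (cut nd Rx Rz (¬⟂ E)) sing Srest (All.tabulate cut∈)
                        (ℕ.≤-trans (ℕ.≤-pred (short E)) le))
    where
    Sx : S (pivot E)
    Sx = ⟪⟫-minimal (proj₁ sing) SX (pivot∈ E)
    Rx : R (pivot E)
    Rx = ⟪⟫-minimal (nd .subspace) (Rq ∷ RX) (pivot∈ E)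
    Srest : All S (rest E)
    Srest = All.map (⟪⟫-minimal (proj₁ sing) SX) (rest⊆ E)
    cut∈ : ∀ {p} → p ∈ rest E → Cut R (pivot E) z p
    cut∈ p∈ = ⟪⟫-minimal (nd .subspace) (Rq ∷ RX) (All.lookup (rest⊆ E) p∈)
            , proj₂ sing _ _ Sx (All.lookup Srest p∈) , All.lookup (rest⟂ E) p∈
    extend : _ → _
    extend (L , hyp , L⊆ , ⊆L , len) =
      (pivot E , z) ∷ L , (Rx , Rz , ¬⟂ E , hyp)
      , pivot∈ E ∷ All.map (⟪⟫-minimal span-subspace (rest⊆ E)) L⊆
      , All.map (⟪⟫-minimal span-subspace (base (here refl) ∷ All.map ⟪⟫-there ⊆L)) (spans E)
      , ℕ.≤-trans (s≤s len) (short E)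

  -- Each pair reduces `p` to its projection `q` from `a` into the next cut. A point `t` found there
  -- is collinear with `a`, so it is collinear with `p` only if it is with `q`.
  hyperbolic-dichotomy : ∀ L {R S p} → NonDegenerate R → IsSingular Π S → Hyperbolic R L →
    All S (map proj₁ L) → S p → R p →
    ⟪ map proj₁ L ⟫ p ⊎ ∃[ t ] (R t × All (t ⟂_) (map proj₁ L) × ¬ t ⟂ p)
  hyperbolic-dichotomy [] nd _ _ _ _ Rp with nd .opposite _ Rp
  ... | t , Rt , ¬tp = inj₂ (t , Rt , [] , ¬tp)
  hyperbolic-dichotomy ((a , b) ∷ L) {p = p} nd sing (Ra , Rb , ¬ba , hyp) (Sa ∷ SL) Sp Rp with p ≟ a
  ... | yes refl = inj₁ (base (here refl))
  ... | no p≢a with project sing Sa Sp ¬ba p≢a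
  ... | q , l , Sq , bq , q≢a , al , pl , ql
    with hyperbolic-dichotomy L (cut nd Ra Rb ¬ba) sing hyp SL Sq
           (nd .subspace p a q l p≢a Rp Ra pl al ql , proj₂ sing a q Sa Sq , bq)
  ... | inj₁ q∈ = inj₁ (line q≢a (⟪⟫-there q∈) (base (here refl)) ql al pl)
  ... | inj₂ (t , (Rt , at , _) , tL , ¬tq) =
    inj₂ (t , Rt , ⟂-sym at ∷ tL , λ tp → ¬tq (⟂-line p≢a pl al ql tp (⟂-sym at)))

  dichotomy : ∀ {R S X p} → NonDegenerate R → IsSingular Π S → All S X → All R X → S p → R p →
              ⟪ X ⟫ p ⊎ ∃[ t ] (R t × All (t ⟂_) X × ¬ t ⟂ p)
  dichotomy nd sing SX RX Sp Rp with normalise _ nd sing SX RX ℕ.≤-refl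
  ... | L , hyp , L⊆ , ⊆L , _
    with hyperbolic-dichotomy L nd sing hyp (All.map (⟪⟫-minimal (proj₁ sing) SX) L⊆) Sp Rp
  ... | inj₁ p∈ = inj₁ (⟪⟫-minimal span-subspace L⊆ p∈)
  ... | inj₂ (t , Rt , tL , ¬tp) = inj₂ (t , Rt , All.map (⟪⟫-minimal (⟂-subspace t) tL) ⊆L , ¬tp)

  -- The dichotomy is applied inside the perp of `x` and `u`: a point `t` separating `p` from `X`
  -- there would be collinear with `x` and `X`, hence with `p`.
  span-∩⟂ : ∀ {S X x u p} → IsSingular Π S → S x → All S X → ¬ u ⟂ x → All (u ⟂_) X →
            ⟪ x ∷ X ⟫ p → u ⟂ p → ⟪ X ⟫ p
  span-∩⟂ {x = x} {u} {p} sing Sx SX ¬ux uX p∈ up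
    with dichotomy (cut everything tt tt ¬ux) sing SX
           (All.zipWith (λ { (Sy , uy) → tt , proj₂ sing _ _ Sx Sy , uy }) (SX , uX))
           Sp (tt , proj₂ sing _ _ Sx Sp , up)
    where Sp = ⟪⟫-minimal (proj₁ sing) (Sx ∷ SX) p∈
  ... | inj₁ p∈X = p∈X
  ... | inj₂ (t , (_ , xt , _) , tX , ¬tp) =
    contradiction (⟪⟫-minimal (⟂-subspace t) (⟂-sym xt ∷ tX) p∈) ¬tp

  -- Exchange, bases and dimension.

  -- The point `z` separating the head of `Q` from its tail is used to eliminate in `W`. The tail
  -- lies in z^⊥, so by `span-∩⟂` it lies in the span of the strictly shorter `rest`.
  steinitz : ∀ {S W Q} → IsSingular Π S → All S W → Triangular Q → All ⟪ W ⟫ Q →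
             length Q ≤ length W
  steinitz sing SW [] [] = z≤n
  steinitz sing SW (triang z ¬zq zQ t) (q∈ ∷ Q⊆) with eliminate sing SW z
  ... | inj₁ zW = contradiction (⟪⟫-minimal (⟂-subspace z) zW q∈) ¬zq
  ... | inj₂ E = ℕ.≤-trans (s≤s (steinitz sing Srest t (All.zipWith reduce (Q⊆ , zQ)))) (short E)
    where
    into = λ {p} → ⟪⟫-minimal {p = p} (proj₁ sing) SW
    Srest = All.map into (rest⊆ E)
    reduce : ∀ {p} → ⟪ _ ⟫ p × z ⟂ p → ⟪ rest E ⟫ p
    reduce (p∈ , zp) = span-∩⟂ sing (into (pivot∈ E)) Srest (¬⟂ E) (rest⟂ E)
                         (⟪⟫-minimal span-subspace (spans E) p∈) zp

  triangular-∷ : ∀ {S X p} → IsSingular Π S → All S X → S p → ¬ ⟪ X ⟫ p →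
                 Triangular X → Triangular (p ∷ X)
  triangular-∷ sing SX Sp p∉ t with dichotomy everything sing SX (All.map _ SX) Sp tt
  ... | inj₁ p∈ = contradiction p∈ p∉
  ... | inj₂ (z , _ , zX , ¬zp) = triang z ¬zp zX t

  span? : ∀ {S X p} → IsSingular Π S → All S X → S p → Dec (⟪ X ⟫ p)
  span? sing SX Sp with dichotomy everything sing SX (All.map _ SX) Sp tt
  ... | inj₁ p∈ = yes p∈
  ... | inj₂ (z , _ , zX , ¬zp) = no λ p∈ → ¬zp (⟪⟫-minimal (⟂-subspace z) zX p∈)

  record Basis (S : PSet Π) (k : ℕ) : Set where
    field
      vectors     : List Pt
      size        : length vectors ≡ k
      independent : Triangular vectors
      inside      : All S vectors
      generates   : ∀ {p} → S p → ⟪ vectors ⟫ p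

  open Basis

  -- Leaving the avoiding subspaces arbitrary serves two purposes: they are spans of the remaining
  -- entries for an independent family, and images of neighbouring vertices for the points of a
  -- cube.
  triangular-tabulate-++ : ∀ {S X} k (v : Fin k → Pt) → IsSingular Π S → (∀ i → S (v i)) →
    All S X → Triangular X →
    (∀ i → ∃[ T ] (IsSubspace Π T × (∀ j → j ≢ i → T (v j)) × All T X × ¬ T (v i))) →
    Triangular (tabulate v ++ X)
  triangular-tabulate-++ zero v sing Sv SX t avoid = t
  triangular-tabulate-++ (suc k) v sing Sv SX t avoid with avoid zero
  ... | T , sub , Tv , TX , ¬Tv0 =
    triangular-∷ sing (All.++⁺ (All.tabulate⁺ (Sv ∘ suc)) SX) (Sv zero)
      (¬Tv0 ∘ ⟪⟫-minimal sub (All.++⁺ (All.tabulate⁺ (λ j → Tv (suc j) λ ())) TX))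
      (triangular-tabulate-++ k (v ∘ suc) sing (Sv ∘ suc) SX t
        λ i → let T , sub , Tv , TX , ¬Tvi = avoid (suc i)
              in T , sub , (λ j j≢i → Tv (suc j) (j≢i ∘ Fin.suc-injective)) , TX , ¬Tvi)

  triangular-tabulate : ∀ {S} k (v : Fin k → Pt) → IsSingular Π S → (∀ i → S (v i)) →
    (∀ i → ¬ Span Π (RangeExcept Π v i) (v i)) → Triangular (tabulate v)
  triangular-tabulate k v sing Sv indep = subst Triangular (List.++-identityʳ _)
    (triangular-tabulate-++ k v sing Sv [] [] λ i →
      Span Π (RangeExcept Π v i) , span-subspace , (λ j j≢i → base (j , j≢i , refl)) , [] , indep i)

  dim⇒basis : ∀ {S k} → IsSingular Π S → DimSucc Π S k → Basis S k
  dim⇒basis {S} {k} sing ((v , (_ , indep) , v⊆ , ⊆v) , _) = record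
    { vectors = tabulate v
    ; size = List.length-tabulate v
    ; independent = triangular-tabulate k v sing Sv indep
    ; inside = All.tabulate⁺ Sv
    ; generates = λ Sp → span-minimal span-subspace
        (λ { _ (i , refl) → base (∈.∈-tabulate⁺ i) }) _ (⊆v _ Sp) }
    where
    Sv : ∀ i → S (v i)
    Sv i = v⊆ _ (base (i , refl))

  range-bound : ∀ {S X k} (w : Fin k → Pt) → IsSingular Π S → (∀ i → S (w i)) → Triangular X →
                (∀ i → Span Π (Range Π w) (lookup X i)) → length X ≤ k
  range-bound w sing Sw triX X⊆ = subst (_ ≤_) (List.length-tabulate w)
    (steinitz sing (All.tabulate⁺ Sw) triX (All.tabulate λ x∈ → span-minimal span-subspace
      (λ { _ (i , refl) → base (∈.∈-tabulate⁺ i) }) _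
      (subst (Span Π (Range Π w)) (sym (Any.lookup-index x∈)) (X⊆ _))))

  -- If one entry lay in the span of the others, these would span the whole list with one point
  -- fewer, against `range-bound`.
  triangular⇒independent : ∀ {S} X → IsSingular Π S → All S X → Triangular X →
                           Independent Π (lookup X)
  triangular⇒independent {S} (x ∷ X) sing SX triX = injective , indep
    where
    v = lookup (x ∷ X)
    indep : ∀ i → ¬ Span Π (RangeExcept Π v i) (v i)
    indep i vi∈ = ℕ.1+n≰n (range-bound (v ∘ Fin.punchIn i) sing
                     (λ j → All.lookup SX (∈.∈-lookup (Fin.punchIn i j))) triX covered)
      where
      other : ∀ {p} → RangeExcept Π v i p → Span Π (Range Π (v ∘ Fin.punchIn i)) p
      other (j , j≢i , e) =
        base (Fin.punchOut (j≢i ∘ sym) , trans (cong v (Fin.punchIn-punchOut (j≢i ∘ sym))) e)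
      covered : ∀ j → Span Π (Range Π (v ∘ Fin.punchIn i)) (v j)
      covered j with j Fin.≟ i
      ... | yes refl = span-minimal span-subspace (λ _ → other) _ vi∈
      ... | no j≢i = other (j , j≢i , refl)
    injective : ∀ i j → v i ≡ v j → i ≡ j
    injective i j e with i Fin.≟ j
    ... | yes i≡j = i≡j
    ... | no i≢j = contradiction (base (j , i≢j ∘ sym , sym e)) (indep i)
  triangular⇒independent [] _ _ _ = (λ ()) , λ ()

  basis⇒dim : ∀ {S k} → IsSingular Π S → Basis S k → DimSucc Π S k
  basis⇒dim {S} {k} sing b = subst (DimSucc Π S) (size b)
    ( (v , triangular⇒independent X sing (inside b) (independent b)
         , span-minimal (proj₁ sing) (λ { _ (i , refl) → Sv i })
         , λ p Sp → span-minimal span-subspace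
             (λ _ x∈ → base (_ , sym (Any.lookup-index x∈))) p (generates b Sp))
    , λ { _ (w , _ , w⊆ , ⊆w) → range-bound w sing (λ i → w⊆ _ (base (i , refl)))
            (independent b) (λ i → ⊆w _ (Sv i)) })
    where
    X = vectors b
    v = lookup X
    Sv : ∀ i → S (v i)
    Sv i = All.lookup (inside b) (∈.∈-lookup i)

  -- Orthogonal families of hyperbolic pairs, and frames.

  side : Bool → Pt × Pt → Pt
  side true = proj₁
  side false = proj₂

  hyperbolic-∈ : ∀ {R} L → Hyperbolic R L → ∀ i b → R (side b (lookup L i))
  hyperbolic-∈ (_ ∷ L) (Ra , Rb , _) zero true = Ra
  hyperbolic-∈ (_ ∷ L) (Ra , Rb , _) zero false = Rb
  hyperbolic-∈ (_ ∷ L) (_ , _ , _ , hyp) (suc i) b = proj₁ (hyperbolic-∈ L hyp i b)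

  hyperbolic-¬⟂ : ∀ {R} L → Hyperbolic R L → ∀ i → ¬ proj₂ (lookup L i) ⟂ proj₁ (lookup L i)
  hyperbolic-¬⟂ (_ ∷ L) (_ , _ , ¬ba , _) zero = ¬ba
  hyperbolic-¬⟂ (_ ∷ L) (_ , _ , _ , hyp) (suc i) = hyperbolic-¬⟂ L hyp i

  side-⟂ : ∀ {e p} b → proj₁ e ⟂ p × proj₂ e ⟂ p → side b e ⟂ p
  side-⟂ true = proj₁
  side-⟂ false = proj₂

  hyperbolic-⟂ : ∀ {R} L → Hyperbolic R L → ∀ i j b c → i ≢ j →
                 side b (lookup L i) ⟂ side c (lookup L j)
  hyperbolic-⟂ (_ ∷ L) _ zero zero b c i≢j = contradiction refl i≢j
  hyperbolic-⟂ (e ∷ L) (_ , _ , _ , hyp) zero (suc j) b c _ =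
    side-⟂ b (proj₂ (hyperbolic-∈ L hyp j c))
  hyperbolic-⟂ (e ∷ L) (_ , _ , _ , hyp) (suc i) zero b c _ =
    ⟂-sym (side-⟂ c (proj₂ (hyperbolic-∈ L hyp i b)))
  hyperbolic-⟂ (_ ∷ L) (_ , _ , _ , hyp) (suc i) (suc j) b c i≢j =
    hyperbolic-⟂ L hyp i j b c (i≢j ∘ cong suc)

  cut-all : ∀ {R} m (g : Fin m → Bool → Pt) → NonDegenerate R → (∀ i b → R (g i b)) →
            (∀ i → ¬ g i false ⟂ g i true) → (∀ i j b c → i ≢ j → g i b ⟂ g j c) →
            NonDegenerate (λ r → R r × (∀ i b → g i b ⟂ r))
  cut-all zero g nd _ _ _ .subspace a b c l a≢b (Ra , _) (Rb , _) al bl cl =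
    nd .subspace a b c l a≢b Ra Rb al bl cl , λ ()
  cut-all zero g nd _ _ _ .opposite p (Rp , _) with nd .opposite p Rp
  ... | q , Rq , ¬qp = q , (Rq , λ ()) , ¬qp
  cut-all {R} (suc m) g nd Rg opp orth = record
    { subspace = λ a b c l a≢b Ra Rb al bl cl →
        from (later .subspace a b c l a≢b (to Ra) (to Rb) al bl cl)
    ; opposite = λ p Rp → let q , Rq , ¬qp = later .opposite p (to Rp) in q , from Rq , ¬qp }
    where
    R' = Cut R (g zero true) (g zero false)
    later : NonDegenerate (λ r → R' r × (∀ i b → g (suc i) b ⟂ r))
    later = cut-all m (g ∘ suc) (cut nd (Rg zero true) (Rg zero false) (opp zero))
      (λ i b → Rg (suc i) b , orth zero (suc i) true b (λ ()) , orth zero (suc i) false b λ ())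
      (opp ∘ suc) (λ i j b c i≢j → orth (suc i) (suc j) b c (i≢j ∘ Fin.suc-injective))
    to : ∀ {r} → R r × (∀ i b → g i b ⟂ r) → R' r × (∀ i b → g (suc i) b ⟂ r)
    to (Rr , gr) = (Rr , gr zero true , gr zero false) , λ i → gr (suc i)
    from : ∀ {r} → R' r × (∀ i b → g (suc i) b ⟂ r) → R r × (∀ i b → g i b ⟂ r)
    from ((Rr , tr , fr) , gr) = Rr , λ { zero true → tr ; zero false → fr ; (suc i) b → gr i b }

  -- Injectivity follows from the collinearities: if two labels gave the same point, it would be
  -- collinear with the opposite of one of them, because that is not the opposite of the other.
  labelled-frame : ∀ {A : Set} n (label : Fin (2 * n) ↔ A) (opp : A → A) (P : A → Pt) →
    (∀ a → opp (opp a) ≡ a) → (∀ a → ¬ P a ⟂ P (opp a)) → (∀ a b → a ≢ opp b → P a ⟂ P b) →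
    IsFrame Π n (P ∘ Inverse.to label)
  labelled-frame n label opp P invol ¬opp orth = injective , λ i →
      from (opp (to i))
    , (λ i⟂ → ¬opp (to i) (subst (λ a → P (to i) ⟂ P a) (strictlyInverseˡ _) i⟂))
    , unique i
    where
    open Inverse label
    to-injective : ∀ {i j} → to i ≡ to j → i ≡ j
    to-injective e = trans (sym (strictlyInverseʳ _)) (trans (cong from e) (strictlyInverseʳ _))
    injective : ∀ i j → P (to i) ≡ P (to j) → i ≡ j
    injective i j e with i Fin.≟ j
    ... | yes i≡j = i≡j
    ... | no i≢j = contradiction
      (subst (_⟂ P (opp (to i))) (sym e)
        (orth (to j) (opp (to i)) λ e' → i≢j (to-injective (sym (trans e' (invol _))))))
      (¬opp (to i))
    unique : ∀ i j → ¬ P (to i) ⟂ P (to j) → j ≡ from (opp (to i))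
    unique i j ¬ij with j Fin.≟ from (opp (to i))
    ... | yes e = e
    ... | no j≢ = contradiction
      (orth (to i) (to j) λ e → j≢ (trans (sym (strictlyInverseʳ j))
        (cong from (trans (sym (invol _)) (cong opp (sym e))))))
      ¬ij

  -- Maximal singular subspaces and distance in the Grassmann graph.

  module Rank (n : ℕ) (rank : ∀ S → IsMaxSingular Π S → DimSucc Π S n) where

    Γ : Graph _ _
    Γ = Grassmann Π n

    ⟨_⟩ : MaxSub Π → PSet Π
    ⟨_⟩ = proj₁

    singular : ∀ S → IsSingular Π ⟨ S ⟩
    singular (_ , sing , _) = sing

    basis : ∀ S → Basis ⟨ S ⟩ n
    basis S = dim⇒basis (singular S) (rank _ (proj₂ S))

    ⟂-max : ∀ S {X p} → All ⟨ S ⟩ X → (∀ {q} → ⟨ S ⟩ q → ⟪ X ⟫ q) → All (p ⟂_) X → ⟨ S ⟩ p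
    ⟂-max S {X} {p} SX gen pX = proj₂ (proj₂ S) ⟪ p ∷ X ⟫ (span-singular clique)
                                 (λ _ Sq → ⟪⟫-there (gen Sq)) p (base (here refl))
      where
      clique : ∀ q r → q ∈ p ∷ X → r ∈ p ∷ X → q ⟂ r
      clique _ _ (here refl) (here refl) = inj₁ refl
      clique _ _ (here refl) (there r∈) = All.lookup pX r∈
      clique _ _ (there q∈) (here refl) = ⟂-sym (All.lookup pX q∈)
      clique q r (there q∈) (there r∈) =
        proj₂ (singular S) q r (All.lookup SX q∈) (All.lookup SX r∈)

    _∈?_ : ∀ p S → Dec (⟨ S ⟩ p)
    p ∈? S with All.all? (p ⟂?_) (vectors (basis S))
    ... | yes pX = yes (⟂-max S (inside (basis S)) (generates (basis S)) pX)
    ... | no ¬pX = no λ Sp → ¬pX (All.map (proj₂ (singular S) p _ Sp) (inside (basis S)))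

    inclusion? : ∀ S T → _⊆_ Π ⟨ S ⟩ ⟨ T ⟩ ⊎ ∃[ p ] (⟨ S ⟩ p × ¬ ⟨ T ⟩ p)
    inclusion? S T with All.all? (_∈? T) (vectors (basis S))
    ... | yes X⊆T = inj₁ λ _ Sp → ⟪⟫-minimal (proj₁ (singular T)) X⊆T (generates (basis S) Sp)
    ... | no X⊈T with find (All.¬All⇒Any¬ (_∈? T) _ X⊈T)
    ... | p , p∈ , ¬Tp = inj₂ (p , All.lookup (inside (basis S)) p∈ , ¬Tp)

    max-⊆ : ∀ S T → _⊆_ Π ⟨ S ⟩ ⟨ T ⟩ → _≐_ Π ⟨ S ⟩ ⟨ T ⟩
    max-⊆ S T S⊆T = S⊆T , proj₂ (proj₂ S) ⟨ T ⟩ (singular T) S⊆T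

    triangular-≤ : ∀ S {X} → Triangular X → All ⟨ S ⟩ X → length X ≤ n
    triangular-≤ S t SX = subst (_ ≤_) (size (basis S))
      (steinitz (singular S) (inside (basis S)) t (All.map (generates (basis S)) SX))

    triangular-full : ∀ S {X p} → Triangular X → All ⟨ S ⟩ X → n ≤ length X → ⟨ S ⟩ p → ⟪ X ⟫ p
    triangular-full S t SX n≤ Sp with span? (singular S) SX Sp
    ... | yes p∈ = p∈
    ... | no p∉ = contradiction
      (ℕ.≤-trans (triangular-≤ S (triangular-∷ (singular S) SX Sp p∉ t) (Sp ∷ SX)) n≤) ℕ.1+n≰n

    -- The maximal singular subspace spanned by u and u^⊥ ∩ S.
    towards : ∀ S u → ¬ ⟨ S ⟩ u →
              ∃[ T ] (Graph.Adj Γ S T × ⟨ T ⟩ u × (∀ p → ⟨ S ⟩ p → u ⟂ p → ⟨ T ⟩ p))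
    towards S u ¬Su with eliminate (singular S) (inside (basis S)) u
    ... | inj₁ uX = contradiction (⟂-max S (inside (basis S)) (generates (basis S)) uX) ¬Su
    ... | inj₂ E = T , basis⇒dim (∩-singular (singular S) (singular T)) ∩-basis , base (here refl) , λ p Sp up → ⟪⟫-there (S∩u⊥ Sp up)
      where
      X = vectors (basis S)
      sub = proj₁ (singular S)
      x = pivot E
      Y = rest E
      Sx : ⟨ S ⟩ x
      Sx = ⟪⟫-minimal sub (inside (basis S)) (pivot∈ E)
      SY : All ⟨ S ⟩ Y
      SY = All.map (⟪⟫-minimal sub (inside (basis S))) (rest⊆ E)
      gen : ∀ {p} → ⟨ S ⟩ p → ⟪ x ∷ Y ⟫ p
      gen Sp = ⟪⟫-minimal span-subspace (spans E) (generates (basis S) Sp)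
      S∩u⊥ : ∀ {p} → ⟨ S ⟩ p → u ⟂ p → ⟪ Y ⟫ p
      S∩u⊥ Sp up = span-∩⟂ (singular S) Sx SY (¬⟂ E) (rest⟂ E) (gen Sp) up
      clique : ∀ q r → q ∈ u ∷ Y → r ∈ u ∷ Y → q ⟂ r
      clique _ _ (here refl) (here refl) = inj₁ refl
      clique _ _ (here refl) (there r∈) = All.lookup (rest⟂ E) r∈
      clique _ _ (there q∈) (here refl) = ⟂-sym (All.lookup (rest⟂ E) q∈)
      clique q r (there q∈) (there r∈) =
        proj₂ (singular S) q r (All.lookup SY q∈) (All.lookup SY r∈)
      maximal : ∀ W → IsSingular Π W → _⊆_ Π ⟪ u ∷ Y ⟫ W → _⊆_ Π W ⟪ u ∷ Y ⟫
      maximal W sing ⊆W t Wt with t ≟ u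
      ... | yes refl = base (here refl)
      -- `t'` is the foot of the pivot `x` on the line `ut`. Being collinear with `x` and `Y`, it
      -- lies in `S`, and being collinear with `u`, in the span of `Y`.
      ... | no t≢u with project sing (⊆W u (base (here refl))) Wt (¬⟂ E ∘ ⟂-sym) t≢u
      ... | t' , l , Wt' , xt' , t'≢u , ul , tl , t'l =
        line t'≢u (⟪⟫-there (S∩u⊥ St' (inj₂ (l , ul , t'l)))) (base (here refl)) t'l ul tl
        where
        St' : ⟨ S ⟩ t'
        St' = ⟂-max S (Sx ∷ SY) gen
          (⟂-sym xt' ∷ All.tabulate (λ y∈ → proj₂ sing _ _ Wt' (⊆W _ (base (there y∈)))))
      T : MaxSub Π
      T = ⟪ u ∷ Y ⟫ , span-singular clique , maximal
      ∩-basis : Basis (_∩_ Π ⟨ S ⟩ ⟨ T ⟩) (n ∸ 1)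
      ∩-basis = record
        { vectors = Y
        ; size = cong (_∸ 1) (trans (ℕ.≤-antisym (short E) (proj₂ (tri E (independent (basis S)))))
                                    (size (basis S)))
        ; independent = proj₁ (tri E (independent (basis S)))
        ; inside = All.tabulate λ y∈ → All.lookup SY y∈ , base (there y∈)
        ; generates = λ (Sp , Tp) → S∩u⊥ Sp (⟪⟫-minimal (⟂-subspace u) (inj₁ refl ∷ rest⟂ E) Tp) }

    -- While `S` misses a point `u` of `T`, the step towards `u` keeps the common points `X` and
    -- adds `u` to them.
    walk : ∀ j S T {X} → Triangular X → All ⟨ S ⟩ X → All ⟨ T ⟩ X → n ≤ length X + j →
           ∃[ i ] (i ≤ j × Walk Γ S T i)
    walk j S T {X} t SX TX n≤ with inclusion? T S
    ... | inj₁ T⊆S = 0 , z≤n , stop (swap (max-⊆ T S T⊆S))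
    ... | inj₂ (u , Tu , ¬Su) with towards S u ¬Su
    ... | S' , adj , S'u , S∩u⊥⊆S' = extend j n≤
      where
      tri' : Triangular (u ∷ X)
      tri' = triangular-∷ (singular T) TX Tu (¬Su ∘ ⟪⟫-minimal (proj₁ (singular S)) SX) t
      S'X : All ⟨ S' ⟩ X
      S'X = All.zipWith (λ { (Sx , Tx) → S∩u⊥⊆S' _ Sx (proj₂ (singular T) u _ Tu Tx) }) (SX , TX)
      extend : ∀ j → n ≤ length X + j → ∃[ i ] (i ≤ j × Walk Γ S T i)
      -- `X` already has at least `n` entries, so `u ∷ X` would exceed the rank.
      extend zero n≤ = contradiction
        (ℕ.≤-trans (triangular-≤ T tri' (Tu ∷ TX)) (ℕ.≤-trans n≤ (ℕ.≤-reflexive (ℕ.+-identityʳ _))))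
        ℕ.1+n≰n
      extend (suc j) n≤
        with walk j S' T tri' (S'u ∷ S'X) (Tu ∷ TX) (subst (n ≤_) (ℕ.+-suc (length X) j) n≤)
      ... | i , i≤j , w = suc i , s≤s i≤j , step adj w

    -- If `p` were outside `S`, then `p` and `Y` would generate `T`; `u` is collinear with all of
    -- them and would lie in `T` by maximality.
    hyperplane : ∀ S T {Y u p} → Triangular Y → All ⟨ S ⟩ Y → All ⟨ T ⟩ Y → n ≤ suc (length Y) →
                 ⟨ S ⟩ u → ¬ ⟨ T ⟩ u → ⟨ T ⟩ p → u ⟂ p → ⟨ S ⟩ p
    hyperplane S T {Y} {u} {p} t SY TY n≤ Su ¬Tu Tp up with p ∈? S
    ... | yes Sp = Sp
    ... | no ¬Sp = contradiction
      (⟂-max T (Tp ∷ TY) (triangular-full T tri' (Tp ∷ TY) n≤)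
        (up ∷ All.map (proj₂ (singular S) u _ Su) SY)) ¬Tu
      where
      tri' = triangular-∷ (singular T) TY Tp (¬Sp ∘ ⟪⟫-minimal (proj₁ (singular S)) SY) t

    -- The intersection has codimension at most `j`, witnessed by independent common points.
    Overlap : MaxSub Π → MaxSub Π → ℕ → Set
    Overlap S T j = ∃[ X ] (Triangular X × All ⟨ S ⟩ X × All ⟨ T ⟩ X × n ≤ length X + j)

    adjacent-hyperplane : ∀ S T {u p} → Graph.Adj Γ S T →
                          ⟨ S ⟩ u → ¬ ⟨ T ⟩ u → ⟨ T ⟩ p → u ⟂ p → ⟨ S ⟩ p
    adjacent-hyperplane S T adj = hyperplane S T (independent b)
      (All.map proj₁ (inside b)) (All.map proj₂ (inside b))
      (subst (λ k → n ≤ suc k) (sym (size b)) (ℕ.m≤n+m∸n n 1))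
      where b = dim⇒basis (∩-singular (singular S) (singular T)) adj

    -- Each edge costs at most one common point: for `s` in `S` outside `S'`, eliminating against
    -- `s` leaves points of S' ∩ s^⊥, which lie in `S`.
    walk-overlap : ∀ {S T j} → Walk Γ S T j → Overlap S T j
    walk-overlap {S} (stop (S⊆T , _)) =
      vectors b , independent b , inside b , All.map (S⊆T _) (inside b) ,
      ℕ.≤-trans (ℕ.≤-reflexive (sym (size b))) (ℕ.m≤m+n _ 0)
      where b = basis S
    walk-overlap {S} {T} (step {y = S'} {k = j} adj w) with walk-overlap w
    ... | X , t , S'X , TX , n≤ with inclusion? S S'
    ... | inj₁ S⊆S' =
      X , t , All.map (proj₂ (max-⊆ S S' S⊆S') _) S'X , TX , ℕ.≤-trans n≤ (ℕ.+-monoʳ-≤ _ (ℕ.n≤1+n j))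
    ... | inj₂ (s , Ss , ¬S's) with eliminate (singular S') S'X s
    ... | inj₁ sX =
      X , t , All.zipWith (λ { (S'x , sx) → adjacent-hyperplane S S' adj Ss ¬S's S'x sx }) (S'X , sX) ,
      TX , ℕ.≤-trans n≤ (ℕ.+-monoʳ-≤ _ (ℕ.n≤1+n j))
    ... | inj₂ E =
      rest E , proj₁ (tri E t) ,
      All.zipWith (λ { (x∈ , sx) → adjacent-hyperplane S S' adj Ss ¬S's
                                     (⟪⟫-minimal (proj₁ (singular S')) S'X x∈) sx }) (rest⊆ E , rest⟂ E) ,
      All.map (⟪⟫-minimal (proj₁ (singular T)) TX) (rest⊆ E) ,
      ℕ.≤-trans n≤ (ℕ.≤-trans (ℕ.+-monoˡ-≤ j (proj₂ (tri E t))) (ℕ.≤-reflexive (sym (ℕ.+-suc _ j))))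

    -- A larger overlap would let `walk` produce a walk shorter than the distance.
    overlap-≤ : ∀ {S T d X} → Dist Γ S T d → Triangular X → All ⟨ S ⟩ X → All ⟨ T ⟩ X →
                length X + d ≤ n
    overlap-≤ {S} {d = zero} {X} _ t SX _ =
      ℕ.≤-trans (ℕ.≤-reflexive (ℕ.+-identityʳ _)) (triangular-≤ S t SX)
    overlap-≤ {S} {T} {suc d} {X} (_ , least) t SX TX with length X + suc d ℕ.≤? n
    ... | yes le = le
    ... | no ¬le with walk d S T t SX TX
                       (ℕ.≤-pred (ℕ.≤-trans (ℕ.≰⇒> ¬le) (ℕ.≤-reflexive (ℕ.+-suc _ d))))
    ... | i , i≤d , w = contradiction (ℕ.≤-trans (least i w) i≤d) ℕ.1+n≰n

    ⟂-all-max : ∀ S {p} → (∀ q → ⟨ S ⟩ q → p ⟂ q) → ⟨ S ⟩ p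
    ⟂-all-max S p⟂ = ⟂-max S (inside (basis S)) (generates (basis S)) (All.map (p⟂ _) (inside (basis S)))

    -- Common points of the images of vertices and facets.

    module Embedding {m : ℕ} (f : Vec Bool m → MaxSub Π)
                     (dist : ∀ x y → Dist Γ (f x) (f y) (hamming x y))
                     (k : ℕ) (m+k≡n : m + k ≡ n) where

      -- Otherwise p^⊥ ∩ f w = f x ∩ f w contains f w ∩ f y, so f x would be as close to f y as f w is.
      convex : ∀ p → Convex (λ w → ⟨ f w ⟩ p)
      convex p x w y xw xy fxp fyp with p ∈? f w
      ... | yes fwp = fwp
      ... | no ¬fwp with walk-overlap (proj₁ (dist w y))
                       | walk-overlap (subst (Walk Γ (f x) (f w)) xw (proj₁ (dist x w)))
      ... | X , triX , wX , yX , n≤X | Y , triY , xY , wY , n≤Y = contradiction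
        (ℕ.≤-trans (ℕ.≤-reflexive (sym (ℕ.+-suc _ _))) (ℕ.≤-trans
          (overlap-≤ (subst (Dist Γ (f x) (f y)) xy (dist x y)) triX xX yX) n≤X))
        ℕ.1+n≰n
        where
        xX : All ⟨ f x ⟩ X
        xX = All.zipWith (λ { (wq , yq) →
               hyperplane (f x) (f w) triY xY wY (subst (n ≤_) (ℕ.+-comm _ 1) n≤Y)
                 fxp ¬fwp wq (proj₂ (singular (f y)) _ _ fyp yq) }) (wX , yX)

      ⊤ᵐ ⊥ᵐ : Vec Bool m
      ⊤ᵐ = Vec.replicate m true
      ⊥ᵐ = Vec.replicate m false

      M : PSet Π
      M = _∩_ Π ⟨ f ⊤ᵐ ⟩ ⟨ f ⊥ᵐ ⟩

      M-singular : IsSingular Π M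
      M-singular = ∩-singular (singular (f ⊤ᵐ)) (singular (f ⊥ᵐ))

      -- Every vertex lies between the two poles, so convexity makes `M` the intersection of all
      -- images.
      M⊆ : ∀ {p} w → M p → ⟨ f w ⟩ p
      M⊆ w (top , bot) = convex-between (convex _) ⊤ᵐ w ⊥ᵐ (between-poles w) top bot

      M? : ∀ p → Dec (M p)
      M? p = (p ∈? f ⊤ᵐ) ×-dec (p ∈? f ⊥ᵐ)

      dist-poles : Dist Γ (f ⊤ᵐ) (f ⊥ᵐ) m
      dist-poles = subst (Dist Γ (f ⊤ᵐ) (f ⊥ᵐ)) (hamming-poles m) (dist ⊤ᵐ ⊥ᵐ)

      M-≤ : ∀ {X} → Triangular X → All M X → length X + m ≤ n
      M-≤ t MX = overlap-≤ dist-poles t (All.map proj₁ MX) (All.map proj₂ MX)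

      abstract
        M-basis : Basis M k
        M-basis with walk-overlap (proj₁ dist-poles)
        ... | U , triU , topU , botU , n≤ = record
          { vectors = U
          ; size = ℕ.+-cancelʳ-≡ m (length U) k
              (trans (ℕ.≤-antisym (M-≤ triU MU) n≤) (trans (sym m+k≡n) (ℕ.+-comm m k)))
          ; independent = triU
          ; inside = MU
          ; generates = gen }
          where
          MU : All M U
          MU = All.zip (topU , botU)
          gen : ∀ {p} → M p → ⟪ U ⟫ p
          gen Mp with span? M-singular MU Mp
          ... | yes p∈ = p∈
          ... | no p∉ = contradiction
            (ℕ.≤-trans (M-≤ (triangular-∷ M-singular MU Mp p∉ triU) (Mp ∷ MU)) n≤) ℕ.1+n≰n

      U : List Pt
      U = vectors M-basis

      abstract
        -- The poles of a facet are at distance m - 1, so their images share more independent points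
        -- than `M` can hold. A shared point outside `M` spreads over the facet by convexity.
        face-point : ∀ i b → ∃[ p ] (¬ M p × (∀ w → Vec.lookup w i ≡ b → ⟨ f w ⟩ p))
        face-point i b with walk-overlap (proj₁ (dist (⊤ᵐ Vec.[ i ]≔ b) (⊥ᵐ Vec.[ i ]≔ b)))
        ... | X , t , topX , botX , n≤ with All.all? M? X
        ... | yes MX = contradiction
          (ℕ.≤-trans (ℕ.≤-reflexive (trans (sym (ℕ.+-suc _ _)) (cong (length X +_) (hamming-face i b))))
            (ℕ.≤-trans (M-≤ t MX) n≤)) ℕ.1+n≰n
        ... | no ¬MX with find (All.¬All⇒Any¬ M? X ¬MX)
        ... | p , p∈ , ¬Mp = p , ¬Mp , λ { w refl →
          convex-between (convex p) _ w _ (between-face w i) (All.lookup topX p∈) (All.lookup botX p∈) }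

      pt : Fin m → Bool → Pt
      pt i b = proj₁ (face-point i b)

      pt∈ : ∀ i b w → Vec.lookup w i ≡ b → ⟨ f w ⟩ (pt i b)
      pt∈ i b = proj₂ (proj₂ (face-point i b))

      -- The antipode of `w` lies on the facet, so its image contains the point. If the image of `w`
      -- did too, all vertices between them, hence both poles, would follow, putting the point in
      -- `M`.
      pt∉ : ∀ i b w → Vec.lookup w i ≢ b → ¬ ⟨ f w ⟩ (pt i b)
      pt∉ i b w w≢b wp = proj₁ (proj₂ (face-point i b)) (spread ⊤ᵐ , spread ⊥ᵐ)
        where
        antipode : ⟨ f (Vec.map not w) ⟩ (pt i b)
        antipode = pt∈ i b (Vec.map not w)
          (trans (Vec.lookup-map i not w) (sym (Bool.¬-not (w≢b ∘ sym))))
        spread : ∀ v → ⟨ f v ⟩ (pt i b)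
        spread v = convex-between (convex _) w v _ (between-antipodes w v) wp antipode

      pt-⟂ : ∀ i j b c → i ≢ j → pt i b ⟂ pt j c
      pt-⟂ i j b c i≢j = proj₂ (singular (f w)) _ _
        (pt∈ i b w (trans (Vec.lookup∘update′ i≢j (⊤ᵐ Vec.[ i ]≔ b) c) (Vec.lookup∘update i ⊤ᵐ b)))
        (pt∈ j c w (Vec.lookup∘update j (⊤ᵐ Vec.[ i ]≔ b) c))
        where w = (⊤ᵐ Vec.[ i ]≔ b) Vec.[ j ]≔ c

      corner : Vec Bool m → List Pt
      corner x = tabulate (λ i → pt i (Vec.lookup x i))

      corner⊆ : ∀ x → All ⟨ f x ⟩ (corner x)
      corner⊆ x = All.tabulate⁺ (λ i → pt∈ i _ x refl)

      -- The list has m + k = n entries, so independence suffices.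
      corner-generates : ∀ x {p} → ⟨ f x ⟩ p → ⟪ corner x ++ U ⟫ p
      corner-generates x = triangular-full (f x)
        (triangular-tabulate-++ m _ (singular (f x)) (λ i → pt∈ i _ x refl)
          (All.map (M⊆ x) (inside M-basis)) (independent M-basis) avoid)
        (All.++⁺ (corner⊆ x) (All.map (M⊆ x) (inside M-basis)))
        (ℕ.≤-reflexive (sym (trans (List.length-++ (corner x))
          (trans (cong (_+ length U) (List.length-tabulate {n = m} _))
            (trans (cong (m +_) (size M-basis)) m+k≡n)))))
        where
        avoid : ∀ i → ∃[ T ] (IsSubspace Π T × (∀ j → j ≢ i → T (pt j (Vec.lookup x j))) ×
                              All T U × ¬ T (pt i (Vec.lookup x i)))
        avoid i = ⟨ f w ⟩ , proj₁ (singular (f w))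
          , (λ j j≢i → pt∈ j _ w (Vec.lookup∘update′ j≢i x _))
          , All.map (M⊆ w) (inside M-basis)
          , pt∉ i _ w (λ e → Bool.not-¬ refl (trans (sym e) (Vec.lookup∘update i x _)))
          -- The neighbour of `x` across coordinate `i`: its image contains every listed point
          -- except the `i`-th corner point.
          where w = x Vec.[ i ]≔ not (Vec.lookup x i)

      -- Otherwise `pt i false` would be collinear with all generators of the image of `⊤ᵐ` and lie
      -- in it by maximality, against `pt∉`.
      pt-¬⟂ : ∀ i → ¬ pt i false ⟂ pt i true
      pt-¬⟂ i ff⟂tt = pt∉ i false ⊤ᵐ (λ e → Bool.not-¬ {true} refl (trans (sym (Vec.lookup-replicate i true)) e))
        (⟂-max (f ⊤ᵐ) (All.++⁺ (corner⊆ ⊤ᵐ) (All.map (M⊆ ⊤ᵐ) (inside M-basis)))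
          (corner-generates ⊤ᵐ)
          (All.++⁺ (All.tabulate⁺ corner⟂) (All.map U⟂ (inside M-basis))))
        where
        corner⟂ : ∀ j → pt i false ⟂ pt j (Vec.lookup ⊤ᵐ j)
        corner⟂ j with i Fin.≟ j
        ... | yes refl = subst (λ b → pt i false ⟂ pt i b) (sym (Vec.lookup-replicate i true)) ff⟂tt
        ... | no i≢j = pt-⟂ i j _ _ i≢j
        w = ⊤ᵐ Vec.[ i ]≔ false
        U⟂ : ∀ {u} → M u → pt i false ⟂ u
        U⟂ Mu = proj₂ (singular (f w)) _ _ (pt∈ i false w (Vec.lookup∘update i ⊤ᵐ false)) (M⊆ w Mu)

      -- Completion of the facet points to a frame.

      R : PSet Π
      R r = ⊤ × (∀ i b → pt i b ⟂ r)

      R-nondegenerate : NonDegenerate R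
      R-nondegenerate = cut-all m pt everything (λ _ _ → tt) pt-¬⟂ pt-⟂

      M⊆R : ∀ {p} → M p → R p
      M⊆R Mp = tt , λ i b → let w = ⊤ᵐ Vec.[ i ]≔ b in
        proj₂ (singular (f w)) _ _ (pt∈ i b w (Vec.lookup∘update i ⊤ᵐ b)) (M⊆ w Mp)

      abstract
        -- Normalising the basis of `M` inside `R`, the perp of all facet points, makes the
        -- hyperbolic partners collinear with those points as well. Steinitz gives the exact length.
        pole-frame : ∃[ L ] (length L ≡ k × Hyperbolic R L × All M (map proj₁ L) ×
                             All ⟪ map proj₁ L ⟫ U)
        pole-frame with normalise _ R-nondegenerate M-singular (inside M-basis)
                          (All.map M⊆R (inside M-basis)) ℕ.≤-refl
        ... | L , hyp , L⊆ , ⊆L , L≤ =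
          L , trans (ℕ.≤-antisym L≤ ≤L) (size M-basis) , hyp , ML , ⊆L
          where
          ML : All M (map proj₁ L)
          ML = All.map (⟪⟫-minimal (proj₁ M-singular) (inside M-basis)) L⊆
          ≤L : length U ≤ length L
          ≤L = subst (length U ≤_) (List.length-map proj₁ L)
                 (steinitz M-singular ML (independent M-basis) ⊆L)

      L : List (Pt × Pt)
      L = proj₁ pole-frame

      L-hyperbolic : Hyperbolic R L
      L-hyperbolic = proj₁ (proj₂ (proj₂ pole-frame))

      L⊆M : All M (map proj₁ L)
      L⊆M = proj₁ (proj₂ (proj₂ (proj₂ pole-frame)))

      U⊆L : All ⟪ map proj₁ L ⟫ U
      U⊆L = proj₂ (proj₂ (proj₂ (proj₂ pole-frame)))

      Label : Set
      Label = Bool × (Fin m ⊎ Fin (length L))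

      opp : Label → Label
      opp (b , s) = not b , s

      opp-involutive : ∀ a → opp (opp a) ≡ a
      opp-involutive (b , s) = cong (_, s) (Bool.not-involutive b)

      P : Label → Pt
      P (b , inj₁ i) = pt i b
      P (b , inj₂ j) = side b (lookup L j)

      P-¬⟂ : ∀ a → ¬ P a ⟂ P (opp a)
      P-¬⟂ (true , inj₁ i) = pt-¬⟂ i ∘ ⟂-sym
      P-¬⟂ (false , inj₁ i) = pt-¬⟂ i
      P-¬⟂ (true , inj₂ j) = hyperbolic-¬⟂ L L-hyperbolic j ∘ ⟂-sym
      P-¬⟂ (false , inj₂ j) = hyperbolic-¬⟂ L L-hyperbolic j

      P-⟂-distinct : ∀ b c s t → s ≢ t → P (b , s) ⟂ P (c , t)
      P-⟂-distinct b c (inj₁ i) (inj₁ j) s≢t = pt-⟂ i j b c (s≢t ∘ cong inj₁)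
      P-⟂-distinct b c (inj₁ i) (inj₂ j) _ = proj₂ (hyperbolic-∈ L L-hyperbolic j c) i b
      P-⟂-distinct b c (inj₂ i) (inj₁ j) _ = ⟂-sym (proj₂ (hyperbolic-∈ L L-hyperbolic i b) j c)
      P-⟂-distinct b c (inj₂ i) (inj₂ j) s≢t =
        hyperbolic-⟂ L L-hyperbolic i j b c (s≢t ∘ cong inj₂)

      P-⟂ : ∀ a b → a ≢ opp b → P a ⟂ P b
      P-⟂ (b , s) (c , t) a≢ with Sum.≡-dec Fin._≟_ Fin._≟_ s t
      ... | no s≢t = P-⟂-distinct b c s t s≢t
      ... | yes refl with b Bool.≟ c
      ...   | yes refl = inj₁ refl
      ...   | no b≢c = contradiction (cong (_, s) (Bool.¬-not b≢c)) a≢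

      abstract
        label : Fin (2 * n) ↔ Label
        label = subst (λ n → Fin (2 * n) ↔ Label)
          (trans (cong (m +_) (proj₁ (proj₂ pole-frame))) m+k≡n)
          ((Fin.2↔Bool ×-↔ Fin.+↔⊎) ↔-∘ Fin.*↔×)

      B : Fin (2 * n) → Pt
      B = P ∘ Inverse.to label

      B-frame : IsFrame Π n B
      B-frame = labelled-frame n label opp P opp-involutive P-¬⟂ P-⟂

      P∈B : ∀ a → Range Π B (P a)
      P∈B a = Inverse.from label a , cong P (Inverse.strictlyInverseˡ label a)

      L∈B : ∀ {p} → p ∈ map proj₁ L → Range Π B p
      L∈B p∈ with ∈.∈-map⁻ proj₁ p∈
      ... | e , e∈ , refl = subst (Range Π B ∘ proj₁) (sym (Any.lookup-index e∈)) (P∈B (true , inj₂ _))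

      M-spanned : SpannedBySubsetOf Π B M
      M-spanned = (_∈ map proj₁ L) , (λ _ → L∈B)
        , (λ _ → ⟪⟫-minimal (proj₁ M-singular) L⊆M)
        , λ _ Mp → ⟪⟫-minimal span-subspace U⊆L (generates M-basis Mp)

      -- The image of the cube as an apartment over M.

      image⇒apartment : ∀ S → InImage Π f S → InApartmentOver Π B M S
      image⇒apartment S (x , x⊆S , S⊆x) =
          ( (_∈ corner x ++ map proj₁ L) , (λ p → All.lookup (All.++⁺ corner∈B (All.tabulate L∈B)))
          , (λ p p∈ → x⊆S p (⟪⟫-minimal (proj₁ (singular (f x)))
                               (All.++⁺ (corner⊆ x) (All.map (M⊆ x) L⊆M)) p∈))
          , λ p Sp → ⟪⟫-minimal span-subspace
              (All.++⁺ (All.tabulate (base ∘ ∈.∈-++⁺ˡ))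
                (All.map (span-minimal span-subspace (λ _ → base ∘ ∈.∈-++⁺ʳ (corner x)) _) U⊆L))
              (corner-generates x (S⊆x p Sp)))
        , λ p Mp → x⊆S p (M⊆ x Mp)
        where
        corner∈B : All (Range Π B) (corner x)
        corner∈B = All.tabulate⁺ (λ i → P∈B (Vec.lookup x i , inj₁ i))

      apartment⇒image : ∀ S → InApartmentOver Π B M S → InImage Π f S
      apartment⇒image S ((X , X⊆B , X⊆S , S⊆X) , M⊆S) = x , max-⊆ (f x) S λ p fxp →
        ⟪⟫-minimal (proj₁ (singular S)) (All.++⁺ (All.tabulate⁺ chosen) (All.map (M⊆S _) (inside M-basis)))
          (corner-generates x fxp)
        where
        -- If `S` misses `pt i false`, then `pt i true` is collinear with all frame points spanning
        -- `S`, since `pt i false` is its only opposite; by maximality it lies in `S`. The signs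
        -- chosen are the coordinates of `x`.
        choice : ∀ i → ∃[ b ] ⟨ S ⟩ (pt i b)
        choice i with pt i true ∈? S | pt i false ∈? S
        ... | yes S⁺ | _ = true , S⁺
        ... | no _ | yes S⁻ = false , S⁻
        ... | no ¬S⁺ | no ¬S⁻ = contradiction
          (⟂-all-max S λ q Sq → span-minimal (⟂-subspace _) generator⟂ q (S⊆X q Sq)) ¬S⁺
          where
          generator⟂ : ∀ q → X q → pt i true ⟂ q
          generator⟂ q Xq with X⊆B q Xq
          ... | j , refl = P-⟂ (true , inj₁ i) (Inverse.to label j) λ e →
            ¬S⁻ (subst (⟨ S ⟩ ∘ P) (trans (sym (opp-involutive _)) (cong opp (sym e)))
                   (X⊆S q (base Xq)))
        x : Vec Bool m
        x = Vec.tabulate (proj₁ ∘ choice)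
        chosen : ∀ i → ⟨ S ⟩ (pt i (Vec.lookup x i))
        chosen i = subst (⟨ S ⟩ ∘ pt i) (sym (Vec.lookup∘tabulate _ i)) (proj₂ (choice i))

-- Conclusion, and the case m = n.

span-empty : ∀ {Π p} {v : Fin 0 → Incidence.Pt Π} → Span Π (Range Π v) p → Fin 0
span-empty (base (i , _)) = i
span-empty (line _ Sa _ _ _ _) = span-empty Sa

theorem2 : (Π : Incidence) → IsPolarSpace Π → (n : ℕ) → HasRank Π n →
    ((m : ℕ) → m ≤ n →
    (f : Vec Bool m → MaxSub Π) →
    IsIsometricEmbedding (Hypercube m) (Grassmann Π n) f →
    ∃[ M ] (IsSingular Π M × DimSucc Π M (n ∸ m) ×
    Σ (Fin (2 * n) → Incidence.Pt Π) λ B → IsFrame Π n B ×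
    SpannedBySubsetOf Π B M ×
    (∀ S → (InImage Π f S → InApartmentOver Π B M S) ×
    (InApartmentOver Π B M S → InImage Π f S))))
    ×
    ((f : Vec Bool n → MaxSub Π) →
    IsIsometricEmbedding (Hypercube n) (Grassmann Π n) f →
    Σ (Fin (2 * n) → Incidence.Pt Π) λ B → IsFrame Π n B ×
    (∀ S → (InImage Π f S → InApartment Π B S) ×
    (InApartment Π B S → InImage Π f S)))
theorem2 Π polar n (_ , rank) = parabolic , full
  where
  open PolarSpace Π polar
  open Rank n rank
  parabolic : ∀ m → m ≤ n → (f : Vec Bool m → MaxSub Π) →
    IsIsometricEmbedding (Hypercube m) (Grassmann Π n) f → _
  parabolic m m≤n f (_ , iso) =
    M , M-singular , basis⇒dim M-singular M-basis , B , B-frame , M-spanned ,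
    λ S → image⇒apartment S , apartment⇒image S
    where
    open Embedding f (λ x y → proj₁ (iso x y (hamming x y)) (hypercube-dist x y))
      (n ∸ m) (ℕ.m+[n∸m]≡n m≤n)
  full : (f : Vec Bool n → MaxSub Π) → IsIsometricEmbedding (Hypercube n) (Grassmann Π n) f → _
  full f iso with parabolic n ℕ.≤-refl f iso
  -- For m = n the subspace `M` is spanned by an empty family, so it has no points and containing it
  -- is vacuous.
  ... | M , _ , dimM , B , frame , _ , apartment =
    B , frame , λ S → proj₁ ∘ proj₁ (apartment S) , λ inB →
      proj₂ (apartment S) (inB , λ p Mp → contradiction (span-empty (proj₂ (proj₂ (proj₂ (proj₁ dim0))) p Mp)) λ ())
    where
    dim0 : DimSucc Π M 0
    dim0 = subst (DimSucc Π M) (ℕ.n∸n≡0 n) dimM
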